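{- Let $(K,\prec)$ be an abstract elementary class with amalgamation, joint embedding and no maximal models, let $\downarrow^{(1)}$ and $\downarrow^{(2)}$ be independence relations on $K$, and let $M\in K$. Assume: - $\downarrow^{(1)}$ has $(E)_M$ and $(U)_M$; - $\downarrow^{(2)}$ has $(E)_M$, $(U)_M$, $(L)$, $(S)$ and $(T_\ast)_M$. Then $\downarrow^{(1)}_M=\downarrow^{(2)}_M$.
   Context: Setting. $(K,\prec)$ is an abstract elementary class (AEC) with amalgamation, joint embedding and no maximal models; "model" means member of $K$. We work in a monster model $\mathfrak{C}$: the union of a strictly increasing continuous chain $(\mathfrak{C}_i)_i$ of models with $\mathfrak{C}_{i+1}$ universal over $\mathfrak{C}_i$, of length $\mathrm{OR}$ (or a cardinal much bigger than the sizes of all objects considered). Every set is a subset of $\mathfrak{C}$ and every model is a $\prec$-submodel of $\mathfrak{C}$ (so for models, $M\subseteq N$ implies $M\prec N$). For sequences of sets $\bar A=(A_i)_{i\in I}$, $\bar B=(B_i)_{i\in I}$ and a set $C$, $f:\bar A\equiv_C\bar B$ means that $f$ is an automorphism of $\mathfrak{C}$ fixing $C$ pointwise with $f[A_i]=B_i$ for all $i$; $\bar A\equiv_C\bar B$ means such an $f$ exists; $C$ is omitted when empty. Independence relation. A set $\downarrow$ of triples $(A,M,N)$, written $A\downarrow_M N$, with $A$ a set and $M\prec N$ models, such that: (I) if $(A,M,N)\equiv(A',M',N')$ then $A\downarrow_M N$ iff $A'\downarrow_{M'}N'$; (M) if $A\downarrow_M N$, $A'\subseteq A$, $M\prec N'\prec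 N$, then $A'\downarrow_M N'$; (B) if $A\downarrow_M N$ and $M\prec M'\prec N$ then $A\downarrow_{M'}N$. $\downarrow_M$ is the restriction of $\downarrow$ to triples with base $M$. Properties. $(E)$ is the conjunction of $(E_0)$: $A\downarrow_M M$ for all sets $A$ and models $M$; and $(E_1)$: for $M\prec N\prec N'$, if $A\downarrow_M N$ then there is $A'\equiv_N A$ with $A'\downarrow_M N'$. $(U)$: if $A\downarrow_M N$, $A'\downarrow_M N$ and $f:A\equiv_M A'$, then there is $g:A\equiv_N A'$ with $g\upharpoonright A=f\upharpoonright A$. $(S)$: if $A\downarrow_M N$, then there is a model $M'\succ M$ with $A\subseteq M'$ and $N\downarrow_M M'$; if $A$ is a model extending $M$, one can take $M'=A$. $(T_\ast)$: if $M_0\prec M_1\prec M_2$, $A\downarrow_{M_0}M_1$ and $A\downarrow_{M_1}M_2$, then $A\downarrow_{M_0}M_2$. $(T_\ast)_M$ is this statement for $M_0=M$. $(L)$: $\kappa_\alpha(\downarrow)<\infty$ for every cardinal $\alpha$, where $\kappa_\alpha(\downarrow)$ is the least $\lambda$ which is a regular cardinal or $\infty$ such that for every regular $\mu\ge\lambda$, every increasing continuous chain of models $\langle M_i:i\le\mu\rangle$ and every set $A$ of size $\alpha$, there is $i_0<\mu$ with $A\downarrow_{M_{i_0}}M_\mu$. For the other properties $(P)$, $(P)_M$ means that $(P)$ holds when the base model is restricted to be $M$. -}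

module Defs where

open import Data.Fin using (Fin)
open import Data.Nat using (ℕ)
open import Data.Product using (Σ-syntax; ∃-syntax; _×_; proj₁; proj₂)
open import Data.Sum using (_⊎_)
open import Data.Vec using (Vec; map)
open import Function using (_∘_; id)
open import Function.Bundles using (_↔_; _↣_; _⇔_; Inverse)
open import Function.Definitions using (Injective)
open import Level using (Level; _⊔_) renaming (suc to lsuc)
open import Relation.Binary.Construct.Add.Supremum.Strict using (_<⁺_)
open import Relation.Binary.Core using (Rel)
open import Relation.Binary.PropositionalEquality using (_≡_; _≗_)
open import Relation.Binary.Structures using (IsStrictTotalOrder)
open import Relation.Nullary using (¬_)
open import Relation.Nullary.Construct.Add.Supremum using (_⁺; ⊤⁺; [_])
open import Relation.Unary using (Pred; _∈_; _⊆_; _≐_)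
open import Induction.WellFounded using (WellFounded)

-- Throughout, types in Set ℓ play the role of sets, and types in
-- Set (lsuc ℓ) the role of (possibly proper) classes.

range : ∀ {a b} {A : Set a} {B : Set b} → (A → B) → Pred B (a ⊔ b)
range f y = ∃[ x ] f x ≡ y

------------------------------------------------------------------------
-- Well-orders and cardinals

record WellOrder (a : Level) : Set (lsuc a) where
  infix 4 _<_
  field
    Carrier            : Set a
    _<_                : Rel Carrier a
    isStrictTotalOrder : IsStrictTotalOrder _≡_ _<_
    wellFounded        : WellFounded _<_

module _ {a r} {I : Set a} (_<_ : Rel I r) where

  IsLimitPoint : I → Set (a ⊔ r)
  IsLimitPoint δ = (∃[ i ] i < δ) × (∀ {i} → i < δ → ∃[ j ] (i < j × j < δ))

  IsSuccessorOf : I → I → Set (a ⊔ r)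
  IsSuccessorOf j i = i < j × (∀ {k} → i < k → ¬ (k < j))

IsLimitOrdinal : ∀ {a} → WellOrder a → Set a
IsLimitOrdinal W = Carrier × (∀ i → ∃[ j ] i < j)
  where open WellOrder W

-- Cardinals are initial ordinals: no injection into a proper initial
-- segment.  A function from the initial segment below x is represented
-- by the restriction of a total function.
record RegularCardinal (ℓ : Level) : Set (lsuc ℓ) where
  field
    wellOrder : WellOrder ℓ
  open WellOrder wellOrder public
  field
    initial  : ∀ x (g : Carrier → Carrier) →
               Injective _≡_ _≡_ g → ¬ (∀ y → g y < x)
    infinite : ℕ ↣ Carrier
    regular  : ∀ x (g : Carrier → Carrier) →
               ∃[ b ] (∀ {y} → y < x → g y < b)

infix 4 _≤ᶜ_
_≤ᶜ_ : ∀ {ℓ} → RegularCardinal ℓ → RegularCardinal ℓ → Set ℓ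
κ ≤ᶜ μ = RegularCardinal.Carrier κ ↣ RegularCardinal.Carrier μ

-- The order type of the class of all ordinals: proper initial segments
-- are sets, and no set of elements is cofinal.
record IsOR {ℓ} (W : WellOrder (lsuc ℓ)) : Set (lsuc ℓ) where
  open WellOrder W
  field
    setLike   : ∀ i → Σ[ J ∈ Set ℓ ] Σ[ e ∈ (J → Carrier) ] (_< i) ⊆ range e
    unbounded : (J : Set ℓ) (e : J → Carrier) → ∃[ b ] (∀ x → e x < b)

------------------------------------------------------------------------
-- Structures

record Vocabulary (ℓ : Level) : Set (lsuc ℓ) where
  field
    Fun      : Set ℓ
    funArity : Fun → ℕ
    Rln      : Set ℓ
    rlnArity : Rln → ℕ

module _ {ℓ} (τ : Vocabulary ℓ) where
  open Vocabulary τ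

  record Structure (a : Level) : Set (ℓ ⊔ lsuc a) where
    field
      ∣_∣ : Set a
      fun : (F : Fun) → Vec ∣_∣ (funArity F) → ∣_∣
      rln : (R : Rln) → Vec ∣_∣ (rlnArity R) → Set a

open Structure public using (∣_∣)

module _ {ℓ} {τ : Vocabulary ℓ} where
  open Vocabulary τ

  record IsEmbedding {a b} (M : Structure τ a) (N : Structure τ b)
                     (f : ∣ M ∣ → ∣ N ∣) : Set (ℓ ⊔ a ⊔ b) where
    private
      module M = Structure M
      module N = Structure N
    field
      injective : Injective _≡_ _≡_ f
      fun-pres  : ∀ F xs → f (M.fun F xs) ≡ N.fun F (map f xs)
      rln-pres  : ∀ R xs → M.rln R xs ⇔ N.rln R (map f xs)

  infix 4 _≅_
  record _≅_ {a b} (M : Structure τ a) (N : Structure τ b) : Set (ℓ ⊔ a ⊔ b) where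
    field
      bijection : ∣ M ∣ ↔ ∣ N ∣
    open Inverse bijection public using (to; from)
    field
      isEmbedding : IsEmbedding M N to

  -- A small substructure of U, up to the choice of a type that indexes
  -- its universe.
  record Substructure {u} (U : Structure τ u) : Set (lsuc ℓ ⊔ u) where
    field
      str : Structure τ ℓ
      inc : ∣ str ∣ → ∣ U ∣
      isEmbedding : IsEmbedding str U inc

  open Substructure public using (str; inc)

  module _ {u} {U : Structure τ u} {i} {I : Set i} where

    IsUnion : (I → Substructure U) → Set (ℓ ⊔ u ⊔ i)
    IsUnion M = ∀ c → ∃[ k ] c ∈ range (inc (M k))

    IsContinuous : ∀ {r} → Rel I r → (I → Substructure U) → Set (ℓ ⊔ u ⊔ i ⊔ r)
    IsContinuous _<_ M = ∀ {δ} → IsLimitPoint _<_ δ → ∀ x →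
      ∃[ k ] (k < δ × inc (M δ) x ∈ range (inc (M k)))

------------------------------------------------------------------------
-- Abstract elementary classes

-- As types have no global membership relation, an inclusion M ⊆ N is
-- witnessed by a map f : ∣ M ∣ → ∣ N ∣; "M ≺ N via f" says that, when M is
-- identified with its image under f, it is a ≺-submodel of N.
record AEC {ℓ} (τ : Vocabulary ℓ) : Set (lsuc (lsuc ℓ)) where
  infix 4 _≺_via_ _≼_
  field
    Member  : Structure τ ℓ → Set (lsuc ℓ)
    _≺_via_ : (M N : Structure τ ℓ) → (∣ M ∣ → ∣ N ∣) → Set (lsuc ℓ)

  -- M ≺ N for substructures of a common U, via the inclusion inside U.
  _≼_ : ∀ {u} {U : Structure τ u} → Substructure U → Substructure U → Set (lsuc ℓ ⊔ u)
  M ≼ N = ∃[ f ] (inc N ∘ f ≗ inc M × str M ≺ str N via f)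

  IsIncreasing : ∀ {u i r} {U : Structure τ u} {I : Set i} →
                 Rel I r → (I → Substructure U) → Set (lsuc ℓ ⊔ u ⊔ i ⊔ r)
  IsIncreasing _<_ M = ∀ {j k} → j < k → M j ≼ M k

  field
    Member-≅ : ∀ {M N} → M ≅ N → Member M → Member N
    ≺-≅      : ∀ {M M′ N N′ f f′} (p : M ≅ M′) (q : N ≅ N′) →
               _≅_.to q ∘ f ≗ f′ ∘ _≅_.to p → M ≺ N via f → M′ ≺ N′ via f′

    ≺-domain    : ∀ {M N f} → M ≺ N via f → Member M
    ≺-codomain  : ∀ {M N f} → M ≺ N via f → Member N
    ≺-embedding : ∀ {M N f} → M ≺ N via f → IsEmbedding M N f
    ≺-refl      : ∀ {M} → Member M → M ≺ M via id
    ≺-trans     : ∀ {L M N f g} → L ≺ M via f → M ≺ N via g → L ≺ N via (g ∘ f)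

    coherence : ∀ {L M N f g} → IsEmbedding L M f →
                M ≺ N via g → L ≺ N via (g ∘ f) → L ≺ M via f

    -- Tarski–Vaught axioms: U is the union of the chain M.
    chain-upper : (W : WellOrder ℓ) → IsLimitOrdinal W → let open WellOrder W in
                  {U : Structure τ ℓ} (M : Carrier → Substructure U) →
                  (∀ i → Member (str (M i))) →
                  IsIncreasing _<_ M → IsUnion M →
                  Member U × (∀ i → str (M i) ≺ U via inc (M i))
    chain-least : (W : WellOrder ℓ) → IsLimitOrdinal W → let open WellOrder W in
                  {U : Structure τ ℓ} (M : Carrier → Substructure U) →
                  (∀ i → Member (str (M i))) →
                  IsIncreasing _<_ M → IsUnion M →
                  ∀ {N} {h : ∣ U ∣ → ∣ N ∣} →
                  (∀ i → str (M i) ≺ N via (h ∘ inc (M i))) → U ≺ N via h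

    -- Löwenheim–Skolem–Tarski axiom.  A set A ⊆ ∣ M ∣ is given by an
    -- enumeration e : I → ∣ M ∣, injective or not; injective enumerations
    -- give the bound |A| + LS(K).
    LS          : Set ℓ
    LS-infinite : ℕ ↣ LS
    LS-fun      : Vocabulary.Fun τ ↣ LS
    LS-rln      : Vocabulary.Rln τ ↣ LS
    LS-axiom    : ∀ {M} → Member M → {I : Set ℓ} (e : I → ∣ M ∣) →
                  ∃[ N ] ∃[ f ] (N ≺ M via f × range e ⊆ range f × (∣ N ∣ ↣ (I ⊎ LS)))

module _ {ℓ} {τ : Vocabulary ℓ} (K : AEC τ) where
  open AEC K

  Amalgamation : Set (lsuc ℓ)
  Amalgamation = ∀ {M₀ M₁ M₂ f₁ f₂} → M₀ ≺ M₁ via f₁ → M₀ ≺ M₂ via f₂ →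
    ∃[ N ] ∃[ g₁ ] ∃[ g₂ ] (M₁ ≺ N via g₁ × M₂ ≺ N via g₂ × g₁ ∘ f₁ ≗ g₂ ∘ f₂)

  JointEmbedding : Set (lsuc ℓ)
  JointEmbedding = ∀ {M₁ M₂} → Member M₁ → Member M₂ →
    ∃[ N ] ∃[ g₁ ] ∃[ g₂ ] (M₁ ≺ N via g₁ × M₂ ≺ N via g₂)

  NoMaximalModels : Set (lsuc ℓ)
  NoMaximalModels = ∀ {M} → Member M →
    ∃[ N ] ∃[ f ] (M ≺ N via f × (∃[ y ] ¬ (y ∈ range f)))

  -- N is universal over M: every extension M′ of M with ‖M′‖ = ‖M‖ embeds
  -- into N over M.
  UniversalOver : ∀ {M N f} → M ≺ N via f → Set (lsuc ℓ)
  UniversalOver {M} {N} {f} _ = ∀ {M′ g} → M ≺ M′ via g → ∣ M′ ∣ ↔ ∣ M ∣ →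
    ∃[ h ] (M′ ≺ N via h × h ∘ g ≗ f)

  record Monster : Set (lsuc (lsuc ℓ)) where
    field
      ℭ      : Structure τ (lsuc ℓ)
      index  : WellOrder (lsuc ℓ)
      isOR   : IsOR index
    open WellOrder index
    field
      stage      : Carrier → Substructure ℭ
      member     : ∀ i → Member (str (stage i))
      increasing : IsIncreasing _<_ stage
      strict     : ∀ {i j} → i < j → ¬ (range (inc (stage j)) ⊆ range (inc (stage i)))
      continuous : IsContinuous _<_ stage
      universal  : ∀ {i j} (j=i+1 : IsSuccessorOf _<_ j i) →
                   UniversalOver (proj₂ (proj₂ (increasing (proj₁ j=i+1))))
      union      : IsUnion stage

------------------------------------------------------------------------
-- Independence relations

module _ {ℓ} {τ : Vocabulary ℓ} {K : AEC τ} (𝔐 : Monster K) where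
  open AEC K
  open Monster 𝔐

  -- A (small) subset of ℭ, given by a not necessarily injective
  -- enumeration; two of them are the same set when ⟦ A ⟧ ≐ ⟦ B ⟧.
  record Subset : Set (lsuc ℓ) where
    constructor enum
    field
      {Index} : Set ℓ
      elem    : Index → ∣ ℭ ∣

  ⟦_⟧ : Subset → Pred ∣ ℭ ∣ (lsuc ℓ)
  ⟦ A ⟧ = range (Subset.elem A)

  -- M ≺ ℭ means M ≺ ℭᵢ for some stage ℭᵢ.
  record Model : Set (lsuc ℓ) where
    field
      substructure : Substructure ℭ
      submodel     : ∃[ i ] substructure ≼ stage i

  open Model

  universe : Model → Subset
  universe M = enum (inc (substructure M))

  infix 4 _≺_
  _≺_ : Rel Model (lsuc ℓ)
  M ≺ N = substructure M ≼ substructure N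

  Automorphism : Set (lsuc ℓ)
  Automorphism = ℭ ≅ ℭ

  infixr 9 _·_
  _·_ : Automorphism → Subset → Subset
  f · A = enum (_≅_.to f ∘ Subset.elem A)

  infix 4 _∶_≡[_]_ _≡[_]_
  _∶_≡[_]_ : Automorphism → Subset → Subset → Subset → Set (lsuc ℓ)
  f ∶ A ≡[ C ] B = (∀ {c} → c ∈ ⟦ C ⟧ → _≅_.to f c ≡ c) × ⟦ f · A ⟧ ≐ ⟦ B ⟧

  _≡[_]_ : Subset → Subset → Subset → Set (lsuc ℓ)
  A ≡[ C ] B = ∃[ f ] f ∶ A ≡[ C ] B

  record Independence : Set (lsuc (lsuc ℓ)) where
    infix 4 _↓[_]_
    field
      _↓[_]_     : Subset → Model → Model → Set (lsuc ℓ)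
      base       : ∀ {A M N} → A ↓[ M ] N → M ≺ N
      invariance : ∀ {A M N A′ M′ N′} (f : Automorphism) →
                   ⟦ f · A ⟧ ≐ ⟦ A′ ⟧ →
                   ⟦ f · universe M ⟧ ≐ ⟦ universe M′ ⟧ →
                   ⟦ f · universe N ⟧ ≐ ⟦ universe N′ ⟧ →
                   A ↓[ M ] N ⇔ A′ ↓[ M′ ] N′
      monotonicity     : ∀ {A A′ M N N′} → A ↓[ M ] N →
                         ⟦ A′ ⟧ ⊆ ⟦ A ⟧ → M ≺ N′ → N′ ≺ N → A′ ↓[ M ] N′
      baseMonotonicity : ∀ {A M M′ N} → A ↓[ M ] N →
                         M ≺ M′ → M′ ≺ N → A ↓[ M′ ] N

  -- A has the cardinality of the type α.  Cardinals α are represented by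
  -- types of that cardinality.
  HasSize : Subset → Set ℓ → Set (lsuc ℓ)
  HasSize A α = Σ[ e ∈ (α → ∣ ℭ ∣) ] (Injective _≡_ _≡_ e × range e ≐ ⟦ A ⟧)

  -- ⟨ Mᵢ : i ≤ μ ⟩, with M μ at the added top element ⊤⁺.
  record IsChain (μ : RegularCardinal ℓ)
                 (M : RegularCardinal.Carrier μ ⁺ → Model) : Set (lsuc ℓ) where
    open RegularCardinal μ
    field
      increasing : IsIncreasing (_<⁺_ _<_) (substructure ∘ M)
      continuous : IsContinuous (_<⁺_ _<_) (substructure ∘ M)

  module _ (ind : Independence) where
    open Independence ind

    E₀ : Model → Set (lsuc ℓ)
    E₀ M = ∀ A → A ↓[ M ] M

    E₁ : Model → Set (lsuc ℓ)
    E₁ M = ∀ {A N N′} → M ≺ N → N ≺ N′ → A ↓[ M ] N →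
      ∃[ A′ ] (A′ ≡[ universe N ] A × A′ ↓[ M ] N′)

    E : Model → Set (lsuc ℓ)
    E M = E₀ M × E₁ M

    U : Model → Set (lsuc ℓ)
    U M = ∀ {A A′ N} → A ↓[ M ] N → A′ ↓[ M ] N →
      ∀ f → f ∶ A ≡[ universe M ] A′ →
      ∃[ g ] (g ∶ A ≡[ universe N ] A′ × (∀ {a} → a ∈ ⟦ A ⟧ → _≅_.to g a ≡ _≅_.to f a))

    S : Set (lsuc ℓ)
    S = ∀ {A M N} → A ↓[ M ] N →
      (∃[ M′ ] (M ≺ M′ × ⟦ A ⟧ ⊆ ⟦ universe M′ ⟧ × universe N ↓[ M ] M′)) ×
      (∀ {M′} → ⟦ universe M′ ⟧ ≐ ⟦ A ⟧ → M ≺ M′ → universe N ↓[ M ] M′)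

    T∗ : Model → Set (lsuc ℓ)
    T∗ M₀ = ∀ {A M₁ M₂} → M₀ ≺ M₁ → M₁ ≺ M₂ →
      A ↓[ M₀ ] M₁ → A ↓[ M₁ ] M₂ → A ↓[ M₀ ] M₂

    LocalCharacterAt : Set ℓ → RegularCardinal ℓ → Set (lsuc ℓ)
    LocalCharacterAt α κ = ∀ μ → κ ≤ᶜ μ → ∀ M → IsChain μ M →
      ∀ A → HasSize A α → ∃[ i ] A ↓[ M [ i ] ] M ⊤⁺

    -- κ_α(↓) = κ
    IsKappa : Set ℓ → RegularCardinal ℓ → Set (lsuc ℓ)
    IsKappa α κ = LocalCharacterAt α κ × (∀ κ′ → LocalCharacterAt α κ′ → κ ≤ᶜ κ′)

    L : Set (lsuc ℓ)
    L = ∀ α → ∃[ κ ] IsKappa α κ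

{-# OPTIONS --safe #-}

-- If A ↓₁[ M ] N, build by (E) for ↓₂ an increasing continuous chain of
-- stages ℭ_{h i} above M together with copies Nᵢ ≡_M N such that
-- Nᵢ ↓₂[ M ] ℭ_{h i} and Nᵢ is contained in the later stages.  By (E) for ↓₁
-- a copy A′ of A over N is ↓₁-independent over M from the union of the
-- chain, and by (L) there is i with A′ ↓₂[ ℭ_{h i} ] union.  Two uses of (S)
-- around one of (T∗) give A′ ↓₂[ M ] Nᵢ.  As both A′ and the copy of A moved
-- along N ≡_M Nᵢ are ↓₁-independent from Nᵢ over M, (U) for ↓₁ carries this
-- back to A ↓₂[ M ] N.  Conversely, given A ↓₂[ M ] N, (E) for ↓₁ produces a
-- copy of A over M that is ↓₁-independent, hence ↓₂-independent, from N, and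
-- (U) for ↓₂ moves it to A.
module Submission where

open import Defs
open import Axiom.ExcludedMiddle using (ExcludedMiddle)
open import Data.Bool using (Bool; true; false)
open import Data.Bool.Properties using (T-irrelevant)
open import Data.Empty using (⊥-elim)
open import Data.Maybe using (Maybe; just; nothing; maybe′)
open import Data.Nat using (ℕ; zero; suc)
open import Data.Product using (Σ-syntax; ∃; ∃-syntax; _×_; _,_; proj₁; proj₂)
open import Data.Sum using (_⊎_; inj₁; inj₂; [_,_]′)
open import Data.Vec using (map)
open import Data.Vec.Properties using (map-id; map-∘; map-cong)
open import Function using (_∘_; id)
open import Function.Bundles using (_⇔_; mk⇔; mk↔ₛ′; Equivalence; Inverse)
open import Function.Construct.Composition using (_↔-∘_)
open import Function.Construct.Identity using (↔-id; ↣-id)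
open import Function.Construct.Symmetry using (↔-sym)
open import Function.Definitions using (Injective)
open import Induction.WellFounded using (WellFounded; WfRec; Acc; acc; module FixPoint; module All)
open import Level using (Level; Lift; lift; lower) renaming (suc to lsuc)
open import Relation.Binary.Construct.Add.Supremum.Strict using (_<⁺_; [_]; [_]<⊤⁺)
open import Relation.Binary.Core using (Rel)
open import Relation.Binary.Definitions using (tri<; tri≈; tri>)
open import Relation.Binary.PropositionalEquality
  using (_≡_; _≗_; refl; sym; trans; cong; subst)
open import Relation.Binary.Structures using (IsStrictTotalOrder; IsPartialOrder)
open import Relation.Nullary using (yes; no; ¬_)
open import Relation.Nullary.Construct.Add.Supremum using (_⁺; ⊤⁺; [_])
open import Relation.Nullary.Decidable using (True; toWitness; fromWitness; map′)
open import Relation.Unary using (Pred; _∈_; _⊆_; _≐_)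
import Relation.Binary.Construct.StrictToNonStrict as StrictToNonStrict

lowerEM : ∀ {ℓ} → ExcludedMiddle (lsuc ℓ) → ExcludedMiddle ℓ
lowerEM {ℓ} em {P} = map′ lower lift (em {Lift (lsuc ℓ) P})

-- The chains in (L) include their top model, so the recursion that builds one runs along `μ ⁺`.
-- Points below the top are shown accessible first, since the top has only these below it.
<⁺-wellFounded : ∀ {a r} {I : Set a} {_<_ : Rel I r} →
                 WellFounded _<_ → WellFounded (_<⁺_ _<_)
<⁺-wellFounded {I = I} {_<_} wf = below
  where
  finite : ∀ {i} → Acc _<_ i → Acc (_<⁺_ _<_) [ i ]
  finite (acc rs) = acc λ { [ j<i ] → finite (rs j<i) }

  below : WellFounded (_<⁺_ _<_)
  below [ i ] = finite (wf i)
  below ⊤⁺    = acc λ { [ i ]<⊤⁺ → finite (wf i) }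

-- Embeddings and isomorphisms

module _ {ℓ} {τ : Vocabulary ℓ} where
  open Vocabulary τ

  private
    variable
      a b c : Level
      P : Structure τ a
      Q : Structure τ b
      R : Structure τ c

  id-isEmbedding : (P : Structure τ a) → IsEmbedding P P id
  id-isEmbedding P = record
    { injective = id
    ; fun-pres  = λ F xs → cong (Structure.fun P F) (sym (map-id xs))
    ; rln-pres  = λ S xs → mk⇔ (subst (Structure.rln P S) (sym (map-id xs)))
                               (subst (Structure.rln P S) (map-id xs))
    }

  ∘-isEmbedding : ∀ {f g} → IsEmbedding P Q f → IsEmbedding Q R g →
                  IsEmbedding P R (g ∘ f)
  ∘-isEmbedding {P = P} {Q = Q} {R = R} {f} {g} f-emb g-emb = record
    { injective = f.injective ∘ g.injective
    ; fun-pres  = λ F xs → trans (cong g (f.fun-pres F xs))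
        (trans (g.fun-pres F (map f xs))
               (cong (Structure.fun R F) (sym (map-∘ g f xs))))
    ; rln-pres  = λ S xs → mk⇔
        (subst (Structure.rln R S) (sym (map-∘ g f xs)) ∘
          Equivalence.to (g.rln-pres S (map f xs)) ∘ Equivalence.to (f.rln-pres S xs))
        (Equivalence.from (f.rln-pres S xs) ∘ Equivalence.from (g.rln-pres S (map f xs)) ∘
          subst (Structure.rln R S) (map-∘ g f xs))
    }
    where
    module f = IsEmbedding f-emb
    module g = IsEmbedding g-emb

  -- `g` reflects equations and relations, so each condition on `f` can be checked after composing
  -- with `g`. This serves inverses, restrictions of automorphisms and inclusions between
  -- substructures.
  factor-isEmbedding : ∀ {f g h} → IsEmbedding P R h → IsEmbedding Q R g →
                       g ∘ f ≗ h → IsEmbedding P Q f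
  factor-isEmbedding {P = P} {R = R} {Q = Q} {f} {g} {h} h-emb g-emb gf≗h = record
    { injective = λ {x} {y} fx≡fy →
        h.injective (trans (sym (gf≗h x)) (trans (cong g fx≡fy) (gf≗h y)))
    ; fun-pres  = λ F xs → g.injective
        (trans (gf≗h (Structure.fun P F xs)) (trans (h.fun-pres F xs)
          (trans (cong (Structure.fun R F) (sym (map-gf xs)))
                 (sym (g.fun-pres F (map f xs))))))
    ; rln-pres  = λ S xs → mk⇔
        (Equivalence.from (g.rln-pres S (map f xs)) ∘
          subst (Structure.rln R S) (sym (map-gf xs)) ∘ Equivalence.to (h.rln-pres S xs))
        (Equivalence.from (h.rln-pres S xs) ∘ subst (Structure.rln R S) (map-gf xs) ∘
          Equivalence.to (g.rln-pres S (map f xs)))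
    }
    where
    module g = IsEmbedding g-emb
    module h = IsEmbedding h-emb

    map-gf : ∀ {n} → map {n = n} g ∘ map f ≗ map h
    map-gf xs = trans (sym (map-∘ g f xs)) (map-cong gf≗h xs)

  ≅-refl : P ≅ P
  ≅-refl {P = P} = record { bijection = ↔-id _ ; isEmbedding = id-isEmbedding P }

  ≅-sym : P ≅ Q → Q ≅ P
  ≅-sym {P = P} {Q = Q} f = record
    { bijection   = ↔-sym (_≅_.bijection f)
    ; isEmbedding = factor-isEmbedding (id-isEmbedding Q) (_≅_.isEmbedding f)
                                       (Inverse.strictlyInverseˡ (_≅_.bijection f))
    }

  ≅-trans : P ≅ Q → Q ≅ R → P ≅ R
  ≅-trans f g = record
    { bijection   = _≅_.bijection g ↔-∘ _≅_.bijection f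
    ; isEmbedding = ∘-isEmbedding (_≅_.isEmbedding f) (_≅_.isEmbedding g)
    }

-- Suprema in the class of ordinals

module Suprema {ℓ} (em : ExcludedMiddle (lsuc ℓ)) (W : WellOrder (lsuc ℓ)) (isOR : IsOR W) where
  open WellOrder W
  open IsOR isOR
  open IsStrictTotalOrder isStrictTotalOrder using (compare; isStrictPartialOrder)
    renaming (trans to <-trans; irrefl to <-irrefl)
  open StrictToNonStrict _≡_ _<_ using (_≤_) public
  open IsPartialOrder (StrictToNonStrict.isPartialOrder _≡_ _<_ isStrictPartialOrder)
    using () renaming (trans to ≤-trans; antisym to ≤-antisym) public

  <-≤-trans : ∀ {i j k} → i < j → j ≤ k → i < k
  <-≤-trans i<j (inj₁ j<k)  = <-trans i<j j<k
  <-≤-trans i<j (inj₂ refl) = i<j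

  ≤-<-trans : ∀ {i j k} → i ≤ j → j < k → i < k
  ≤-<-trans (inj₁ i<j)  j<k = <-trans i<j j<k
  ≤-<-trans (inj₂ refl) j<k = j<k

  ≮⇒≥ : ∀ {i j} → ¬ (i < j) → j ≤ i
  ≮⇒≥ {i} {j} i≮j with compare i j
  ... | tri< i<j _ _ = ⊥-elim (i≮j i<j)
  ... | tri≈ _ i≡j _ = inj₂ (sym i≡j)
  ... | tri> _ _ j<i = inj₁ j<i

  directed : ∀ i j → ∃[ k ] (i < k × j < k)
  directed i j = let b , below = unbounded (Lift ℓ Bool) pick in
    b , below (lift true) , below (lift false)
    where
    pick : Lift ℓ Bool → Carrier
    pick (lift true)  = i
    pick (lift false) = j

  abstract
    least : (Q : Pred Carrier (lsuc ℓ)) → ∃ Q → ∃[ m ] (Q m × (∀ {b} → b < m → ¬ Q b))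
    least Q (b , Qb) = All.wfRec wellFounded _ (λ i → Q i → ∃[ m ] (Q m × (∀ {b} → b < m → ¬ Q b)))
      step b Qb
      where
      step : ∀ i → (∀ {j} → j < i → Q j → ∃[ m ] (Q m × (∀ {b} → b < m → ¬ Q b))) →
             Q i → ∃[ m ] (Q m × (∀ {b} → b < m → ¬ Q b))
      step i rec Qi with em {∃[ j ] (j < i × Q j)}
      ... | yes (j , j<i , Qj) = rec j<i Qj
      ... | no  minimal        = i , Qi , λ b<i Qb → minimal (_ , b<i , Qb)

  module _ {J : Set ℓ} (e : J → Carrier) where
    private
      leastUpperBound : ∃[ s ] ((∀ x → e x ≤ s) × (∀ {b} → b < s → ¬ (∀ x → e x ≤ b)))
      leastUpperBound = least (λ b → ∀ x → e x ≤ b)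
        (proj₁ (unbounded J e) , inj₁ ∘ proj₂ (unbounded J e))

    sup : Carrier
    sup = proj₁ leastUpperBound

    ≤-sup : ∀ x → e x ≤ sup
    ≤-sup = proj₁ (proj₂ leastUpperBound)

    <-sup : ∀ {b} → b < sup → ∃[ x ] b < e x
    <-sup {b} b<s with em {∃[ x ] b < e x}
    ... | yes exceeded = exceeded
    ... | no  bound    = ⊥-elim
      (proj₂ (proj₂ leastUpperBound) b<s λ x → ≮⇒≥ λ b<ex → bound (x , b<ex))

    sup-least : ∀ {b} → (∀ x → e x ≤ b) → sup ≤ b
    sup-least bound = ≮⇒≥ λ b<s → let x , b<ex = <-sup b<s in
      <-irrefl refl (<-≤-trans b<ex (bound x))

    -- The supremum is not attained, so a value exceeding `b` still lies strictly below it. An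
    -- element of `J` rules out the empty family, whose supremum is the least ordinal.
    sup-isLimitPoint : J → (∀ x → e x < sup) → IsLimitPoint _<_ sup
    sup-isLimitPoint x e<s = (e x , e<s x) , λ b<s → let y , b<ey = <-sup b<s in e y , b<ey , e<s y

  -- Antisymmetry makes pointwise equality suffice, which lets the recursion behind `normal` be
  -- unfolded without function extensionality.
  sup-cong : ∀ {J : Set ℓ} {e e′ : J → Carrier} → e ≗ e′ → sup e ≡ sup e′
  sup-cong {e = e} {e′} e≗e′ = ≤-antisym
    (sup-least e λ x → subst (_≤ sup e′) (sym (e≗e′ x)) (≤-sup e′ x))
    (sup-least e′ λ x → subst (_≤ sup e) (e≗e′ x) (≤-sup e x))

  -- The function `normal i = sup ({start} ∪ {next (normal j) : j ⊏ i})`. One formula covers least,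
  -- successor and limit points, and `next` may be any inflationary map, monotone or not.
  module NormalFunction {I : Set ℓ} {_⊏_ : Rel I ℓ} (wf : WellFounded _⊏_)
                        (start : Carrier) (next : Carrier → Carrier)
                        (next-inflationary : ∀ i → i < next i) where

    private
      values : ∀ i → WfRec _⊏_ (λ _ → Carrier) i → Maybe (∃[ j ] j ⊏ i) → Carrier
      values i rec = maybe′ (λ { (j , j⊏i) → next (rec j⊏i) }) start

      step : ∀ i → WfRec _⊏_ (λ _ → Carrier) i → Carrier
      step i rec = sup (values i rec)

      step-cong : ∀ i {rec rec′ : WfRec _⊏_ (λ _ → Carrier) i} →
                  (∀ {j} j⊏i → rec {j} j⊏i ≡ rec′ j⊏i) → step i rec ≡ step i rec′
      step-cong i eq = sup-cong λ { nothing → refl ; (just (_ , j⊏i)) → cong next (eq j⊏i) }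

    normal : I → Carrier
    normal = All.wfRec wf _ _ step

    approximants : ∀ i → Maybe (∃[ j ] j ⊏ i) → Carrier
    approximants i = values i λ {j} _ → normal j

    normal≡sup : ∀ i → normal i ≡ sup (approximants i)
    normal≡sup i = FixPoint.unfold-wfRec wf _ step step-cong

    start≤normal : ∀ i → start ≤ normal i
    start≤normal i = subst (start ≤_) (sym (normal≡sup i)) (≤-sup (approximants i) nothing)

    next≤normal : ∀ {i j} → j ⊏ i → next (normal j) ≤ normal i
    next≤normal {i} j⊏i =
      subst (next _ ≤_) (sym (normal≡sup i)) (≤-sup (approximants i) (just (_ , j⊏i)))

    normal-strict : ∀ {i j} → j ⊏ i → normal j < normal i
    normal-strict j⊏i = <-≤-trans (next-inflationary _) (next≤normal j⊏i)

    module _ {δ} (δ-limit : IsLimitPoint _⊏_ δ) where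

      approximants-bounded : ∀ x → ∃[ j ] (j ⊏ δ × approximants δ x ≤ normal j)
      approximants-bounded nothing = let j , j⊏δ = proj₁ δ-limit in j , j⊏δ , start≤normal j
      approximants-bounded (just (j , j⊏δ)) =
        let k , j⊏k , k⊏δ = proj₂ δ-limit j⊏δ in k , k⊏δ , next≤normal j⊏k

      -- Continuity at limits: `next (normal j)` is at most `normal k` for any `k` between `j` and
      -- `δ`, so the earlier values of `normal` already have supremum `normal δ`.
      normal-cofinal : ∀ {b} → b < normal δ → ∃[ j ] (j ⊏ δ × b < normal j)
      normal-cofinal b<δ with x , b<x ← <-sup (approximants δ) (subst (_ <_) (normal≡sup δ) b<δ)
                         with j , j⊏δ , x≤j ← approximants-bounded x
                         = j , j⊏δ , <-≤-trans b<x x≤j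

      normal-isLimitPoint : IsLimitPoint _<_ (normal δ)
      normal-isLimitPoint =
        (let j , j⊏δ = proj₁ δ-limit in normal j , normal-strict j⊏δ) ,
        λ b<δ → let j , j⊏δ , b<j = normal-cofinal b<δ in normal j , b<j , normal-strict j⊏δ

-- Models inside the monster

module MonsterProperties {ℓ} (em : ExcludedMiddle (lsuc ℓ)) {τ : Vocabulary ℓ}
                         {K : AEC τ} (𝔐 : Monster K) where
  open AEC K
  open Monster 𝔐
  open WellOrder index
  open IsOR isOR
  open Suprema em index isOR
  open Model

  Mdl : Set (lsuc ℓ)
  Mdl = Model 𝔐

  Sub : Set (lsuc ℓ)
  Sub = Subset 𝔐

  Auto : Set (lsuc ℓ)
  Auto = Automorphism 𝔐

  open _≅_ using (to; from)

  set : Sub → Pred ∣ ℭ ∣ (lsuc ℓ)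
  set = ⟦_⟧ 𝔐

  ∣_∣ᴹ : Mdl → Sub
  ∣_∣ᴹ = universe 𝔐

  infix 4 _⊑_
  _⊑_ : Rel Mdl (lsuc ℓ)
  _⊑_ = _≺_ 𝔐

  ≺-resp-≗ : ∀ {P Q f g} → f ≗ g → P ≺ Q via f → P ≺ Q via g
  ≺-resp-≗ = ≺-≅ ≅-refl ≅-refl

  ≼-refl : ∀ (P : Substructure ℭ) → Member (str P) → P ≼ P
  ≼-refl P P∈K = id , (λ _ → refl) , ≺-refl P∈K

  ≼-trans : ∀ (P Q R : Substructure ℭ) → P ≼ Q → Q ≼ R → P ≼ R
  ≼-trans P Q R (f , f-inc , P≺Q) (g , g-inc , Q≺R) =
    g ∘ f , (λ x → trans (g-inc (f x)) (f-inc x)) , ≺-trans P≺Q Q≺R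

  ≼⇒⊆ : ∀ (P Q : Substructure ℭ) → P ≼ Q → range (inc P) ⊆ range (inc Q)
  ≼⇒⊆ P Q (f , f-inc , _) (x , incx≡c) = f x , trans (f-inc x) incx≡c

  -- Coherence inside `R`: the inclusion `h` is an embedding because `P` and `Q` both embed in `ℭ`,
  -- and `f` factors through it because `inc R` is injective.
  ⊆⇒≼ : ∀ (P Q R : Substructure ℭ) → P ≼ R → Q ≼ R →
        range (inc P) ⊆ range (inc Q) → P ≼ Q
  ⊆⇒≼ P Q R (f , f-inc , P≺R) (g , g-inc , Q≺R) P⊆Q =
    h , h-inc ,
    coherence (factor-isEmbedding P.isEmbedding Q.isEmbedding h-inc) Q≺R (≺-resp-≗ f≗gh P≺R)
    where
    module P = Substructure P
    module Q = Substructure Q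
    module R = Substructure R

    h : ∣ str P ∣ → ∣ str Q ∣
    h x = proj₁ (P⊆Q (x , refl))

    h-inc : inc Q ∘ h ≗ inc P
    h-inc x = proj₂ (P⊆Q (x , refl))

    f≗gh : f ≗ g ∘ h
    f≗gh x = IsEmbedding.injective R.isEmbedding
      (trans (f-inc x) (sym (trans (g-inc (h x)) (h-inc x))))

  stage-mono : ∀ {i j} → i ≤ j → stage i ≼ stage j
  stage-mono (inj₁ i<j)  = increasing i<j
  stage-mono (inj₂ refl) = ≼-refl (stage _) (member _)

  stage-⊆ : ∀ {i j} → i ≤ j → range (inc (stage i)) ⊆ range (inc (stage j))
  stage-⊆ {i} {j} i≤j = ≼⇒⊆ (stage i) (stage j) (stage-mono i≤j)

  stageModel : Carrier → Mdl
  stageModel i = record { substructure = stage i ; submodel = i , ≼-refl (stage i) (member i) }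

  rank : Mdl → Carrier
  rank P = proj₁ (submodel P)

  ⊑-stage : ∀ (P : Mdl) {i} → rank P ≤ i → P ⊑ stageModel i
  ⊑-stage P {i} rank≤i = ≼-trans (substructure P) (stage (rank P)) (stage i)
    (proj₂ (submodel P)) (stage-mono rank≤i)

  ⊆⇒⊑ : ∀ (P Q : Mdl) → set ∣ P ∣ᴹ ⊆ set ∣ Q ∣ᴹ → P ⊑ Q
  ⊆⇒⊑ P Q with k , P<k , Q<k ← directed (rank P) (rank Q) =
    ⊆⇒≼ (substructure P) (substructure Q) (stage k) (⊑-stage P (inj₁ P<k)) (⊑-stage Q (inj₁ Q<k))

  ⊑-refl : ∀ (P : Mdl) → P ⊑ P
  ⊑-refl P = ⊆⇒⊑ P P id

  -- Each point has a stage, and a set-sized family of stage indices is bounded in `OR`.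
  small⇒bounded : {J : Set ℓ} (e : J → ∣ ℭ ∣) → ∃[ i ] range e ⊆ range (inc (stage i))
  small⇒bounded {J} e with i , bound ← unbounded J (proj₁ ∘ union ∘ e) =
    i , λ { (x , refl) → stage-⊆ (inj₁ (bound x)) (proj₂ (union (e x))) }

  sup-continuous : {J : Set ℓ} (e : J → Carrier) → J → (∀ x → e x < sup e) →
                   ∀ {c} → c ∈ range (inc (stage (sup e))) →
                   ∃[ x ] c ∈ range (inc (stage (e x)))
  sup-continuous e x₀ e<s (y , refl)
    with k , k<s , c∈k ← continuous (sup-isLimitPoint e x₀ e<s) y
    with x , k<ex ← <-sup e k<s = x , stage-⊆ (inj₁ k<ex) c∈k

  to-from : ∀ (f : Auto) c → to f (from f c) ≡ c
  to-from f = Inverse.strictlyInverseˡ (_≅_.bijection f)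

  from-to : ∀ (f : Auto) c → from f (to f c) ≡ c
  from-to f = Inverse.strictlyInverseʳ (_≅_.bijection f)

  -- Images of models under automorphisms

  module _ (f : Auto) where

    private
      both : ∀ i → ∣ str (stage i) ∣ ⊎ ∣ str (stage i) ∣ → ∣ ℭ ∣
      both i = [ to f ∘ inc (stage i) , from f ∘ inc (stage i) ]′

    -- A common closure point of f and f⁻¹: iterate a bound ω times.
    invariantStage : ∀ i → ∃[ δ ] (i ≤ δ ×
      (∀ {c} → c ∈ range (inc (stage δ)) → to f c ∈ range (inc (stage δ))) ×
      (∀ {c} → c ∈ range (inc (stage δ)) → from f c ∈ range (inc (stage δ))))
    invariantStage i = sup e , ≤-sup e (lift zero) , closed (to f) (λ j c∈ → bounds j (here j c∈)) ,
                       closed (from f) (λ j c∈ → bounds j (there j c∈))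
      where
      next : Carrier → Carrier
      next j = proj₁ (directed j (proj₁ (small⇒bounded (both j))))

      j<next : ∀ j → j < next j
      j<next j = proj₁ (proj₂ (directed j (proj₁ (small⇒bounded (both j)))))

      bounds : ∀ j {c} → c ∈ range (both j) → c ∈ range (inc (stage (next j)))
      bounds j = stage-⊆ (inj₁ (proj₂ (proj₂ (directed j (proj₁ (small⇒bounded (both j))))))) ∘
                 proj₂ (small⇒bounded (both j))

      here : ∀ j {c} → c ∈ range (inc (stage j)) → to f c ∈ range (both j)
      here j (x , refl) = inj₁ x , refl

      there : ∀ j {c} → c ∈ range (inc (stage j)) → from f c ∈ range (both j)
      there j (x , refl) = inj₂ x , refl

      iterate : ℕ → Carrier
      iterate zero    = i
      iterate (suc n) = next (iterate n)

      e : Lift ℓ ℕ → Carrier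
      e (lift n) = iterate n

      e<s : ∀ x → e x < sup e
      e<s (lift n) = <-≤-trans (j<next (iterate n)) (≤-sup e (lift (suc n)))

      closed : (g : ∣ ℭ ∣ → ∣ ℭ ∣) →
               (∀ j {c} → c ∈ range (inc (stage j)) → g c ∈ range (inc (stage (next j)))) →
               ∀ {c} → c ∈ range (inc (stage (sup e))) → g c ∈ range (inc (stage (sup e)))
      -- A point of the limit stage appears after finitely many iterations, and its image at most
      -- one iteration later.
      closed g g-next c∈s with lift n , c∈n ← sup-continuous e (lift zero) e<s c∈s =
        stage-⊆ (inj₁ (e<s (lift (suc n)))) (g-next (iterate n) c∈n)

    restrict : (S : Substructure ℭ) →
               (∀ {c} → c ∈ range (inc S) → to f c ∈ range (inc S)) →
               (∀ {c} → c ∈ range (inc S) → from f c ∈ range (inc S)) →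
               Σ[ g ∈ str S ≅ str S ] inc S ∘ to g ≗ to f ∘ inc S
    restrict S to-closed from-closed =
      record
        { bijection   = mk↔ₛ′ g g⁻¹
            (λ x → S-injective (trans (g-inc (g⁻¹ x))
              (trans (cong (to f) (g⁻¹-inc x)) (to-from f (inc S x)))))
            (λ x → S-injective (trans (g⁻¹-inc (g x))
              (trans (cong (from f) (g-inc x)) (from-to f (inc S x)))))
        ; isEmbedding = factor-isEmbedding
            (∘-isEmbedding S.isEmbedding (_≅_.isEmbedding f)) S.isEmbedding g-inc
        } , g-inc
      where
      module S = Substructure S

      S-injective : Injective _≡_ _≡_ (inc S)
      S-injective = IsEmbedding.injective S.isEmbedding

      g g⁻¹ : ∣ str S ∣ → ∣ str S ∣
      g x   = proj₁ (to-closed (x , refl))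
      g⁻¹ x = proj₁ (from-closed (x , refl))

      g-inc : inc S ∘ g ≗ to f ∘ inc S
      g-inc x = proj₂ (to-closed (x , refl))

      g⁻¹-inc : inc S ∘ g⁻¹ ≗ from f ∘ inc S
      g⁻¹-inc x = proj₂ (from-closed (x , refl))

    image : Substructure ℭ → Substructure ℭ
    image P = record
      { str = str P
      ; inc = to f ∘ inc P
      ; isEmbedding = ∘-isEmbedding (Substructure.isEmbedding P) (_≅_.isEmbedding f)
      }

    abstract
      -- `f` need not respect the stages, so the stage containing `P` is first enlarged to one that
      -- `f` permutes. There `f` restricts to an automorphism, and `≺` is invariant under
      -- isomorphism.
      image-submodel : (P : Mdl) → ∃[ i ] image (substructure P) ≼ stage i
      image-submodel P
        with δ , P≤δ , to-closed , from-closed ← invariantStage (rank P)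
        with g , g-inc ← restrict (stage δ) to-closed from-closed
        with p , p-inc , P≺δ ← ⊑-stage P P≤δ =
        δ , to g ∘ p , (λ x → trans (g-inc (p x)) (cong (to f) (p-inc x))) ,
        ≺-≅ ≅-refl g (λ _ → refl) P≺δ

    imageModel : Mdl → Mdl
    imageModel P = record
      { substructure = image (substructure P)
      ; submodel     = image-submodel P
      }

  ⊑⇒⊆ : ∀ (P Q : Mdl) → P ⊑ Q → set ∣ P ∣ᴹ ⊆ set ∣ Q ∣ᴹ
  ⊑⇒⊆ P Q = ≼⇒⊆ (substructure P) (substructure Q)

  -- Conjugacy over a set, and cardinality

  infix 4 _∶_≡⟨_⟩_ _≡⟨_⟩_
  _∶_≡⟨_⟩_ : Auto → Sub → Sub → Sub → Set (lsuc ℓ)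
  _∶_≡⟨_⟩_ = _∶_≡[_]_ 𝔐

  _≡⟨_⟩_ : Sub → Sub → Sub → Set (lsuc ℓ)
  _≡⟨_⟩_ = _≡[_]_ 𝔐

  Fixes : Auto → Sub → Set (lsuc ℓ)
  Fixes f C = ∀ {c} → c ∈ set C → to f c ≡ c

  fixes⇒≐ : ∀ f C → Fixes f C → set (_·_ 𝔐 f C) ≐ set C
  fixes⇒≐ f C fixes =
    (λ { (x , eq) → x , trans (sym (fixes (x , refl))) eq }) ,
    (λ { (x , eq) → x , trans (fixes (x , refl)) eq })

  ≡-sym : ∀ f A B C → f ∶ A ≡⟨ C ⟩ B → ≅-sym f ∶ B ≡⟨ C ⟩ A
  ≡-sym f A B C (fixes , fA⊆B , B⊆fA) =
    (λ {c} c∈C → trans (cong (from f) (sym (fixes c∈C))) (from-to f c)) ,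
    (λ { (y , refl) → let x , fx≡y = B⊆fA (y , refl) in
           x , trans (sym (from-to f _)) (cong (from f) fx≡y) }) ,
    (λ { (x , refl) → let y , y≡fx = fA⊆B (x , refl) in
           y , trans (cong (from f) y≡fx) (from-to f _) })

  ≡-trans : ∀ f g A B C D → f ∶ A ≡⟨ D ⟩ B → g ∶ B ≡⟨ D ⟩ C → ≅-trans f g ∶ A ≡⟨ D ⟩ C
  ≡-trans f g A B C D (f-fixes , fA⊆B , B⊆fA) (g-fixes , gB⊆C , C⊆gB) =
    (λ c∈D → trans (cong (to g) (f-fixes c∈D)) (g-fixes c∈D)) ,
    (λ { (x , refl) → let y , y≡fx = fA⊆B (x , refl) in gB⊆C (y , cong (to g) y≡fx) }) ,
    (λ c∈C → let y , gy≡c = C⊆gB c∈C ; x , fx≡y = B⊆fA (y , refl) in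
      x , trans (cong (to g) fx≡y) gy≡c)

  -- (L) asks for an injective enumeration by a type in `Set ℓ`, while the given one may repeat and
  -- `∣ ℭ ∣` is a proper class. Hence `A` is pulled back to a stage, and `α` is carved out of the
  -- universe of that stage.
  hasSize : ∀ A → ∃[ α ] HasSize 𝔐 A α
  hasSize A = α , inc (stage i) ∘ proj₁ , e-injective ,
    (λ { ((t , t∈A) , refl) → let x , fx≡t = toWitness t∈A in
           x , trans (sym (f-inc x)) (cong (inc (stage i)) fx≡t) }) ,
    (λ { (x , refl) → (f x , fromWitness (x , refl)) , f-inc x })
    where
    i : Carrier
    i = proj₁ (small⇒bounded (Subset.elem A))

    f : Subset.Index A → ∣ str (stage i) ∣
    f x = proj₁ (proj₂ (small⇒bounded (Subset.elem A)) (x , refl))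

    f-inc : inc (stage i) ∘ f ≗ Subset.elem A
    f-inc x = proj₂ (proj₂ (small⇒bounded (Subset.elem A)) (x , refl))

    -- True squashes the choice of a preimage, which makes the enumeration injective.
    α : Set ℓ
    α = Σ[ t ∈ ∣ str (stage i) ∣ ] True (lowerEM em {∃[ x ] f x ≡ t})

    e-injective : Injective _≡_ _≡_ (inc (stage i) ∘ proj₁ {B = λ t → True (lowerEM em {∃[ x ] f x ≡ t})})
    e-injective {t , p} {t′ , p′} eq
      with refl ← IsEmbedding.injective (Substructure.isEmbedding (stage i)) eq =
      cong (t ,_) (T-irrelevant p p′)

  hasSize-≡ : ∀ f A B C {α} → f ∶ A ≡⟨ C ⟩ B → HasSize 𝔐 A α → HasSize 𝔐 B α
  hasSize-≡ f A B C (_ , fA⊆B , B⊆fA) (e , e-injective , e⊆A , A⊆e) =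
    to f ∘ e , e-injective ∘ IsEmbedding.injective (_≅_.isEmbedding f) ,
    (λ { (x , refl) → let y , y≡ex = e⊆A (x , refl) in fA⊆B (y , cong (to f) y≡ex) }) ,
    (λ c∈B → let y , fy≡c = B⊆fA c∈B ; x , ex≡y = A⊆e (y , refl) in
      x , trans (cong (to f) ex≡y) fy≡c)

  -- Invariance and independent copies

  module _ (ind : Independence 𝔐) where
    open Independence ind

    ↓-resp-≡ : ∀ {A B M N} f → f ∶ A ≡⟨ ∣ N ∣ᴹ ⟩ B → A ↓[ M ] N → B ↓[ M ] N
    ↓-resp-≡ {A} {B} {M} {N} f (fixes , fA≐B) A↓N =
      Equivalence.to (invariance f fA≐B
        (fixes⇒≐ f ∣ M ∣ᴹ (fixes ∘ ⊑⇒⊆ M N (base A↓N))) (fixes⇒≐ f ∣ N ∣ᴹ fixes)) A↓N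

    ↓-imageModel : ∀ {A M N} f → Fixes f ∣ M ∣ᴹ →
                   A ↓[ M ] N ⇔ _·_ 𝔐 f A ↓[ M ] imageModel f N
    ↓-imageModel {M = M} f fixes =
      invariance f (id , id) (fixes⇒≐ f ∣ M ∣ᴹ fixes) (id , id)

    extension : ∀ {M} → E 𝔐 ind M → ∀ A N → M ⊑ N →
                ∃[ A′ ] (A′ ≡⟨ ∣ M ∣ᴹ ⟩ A × A′ ↓[ M ] N)
    extension {M} (E₀-M , E₁-M) A N M⊑N = E₁-M (⊑-refl M) M⊑N (E₀-M A)

    -- (E) yields only a set conjugate to `N`. Reversing the automorphism presents that set as the
    -- image of `N`, which is again a model.
    independentCopy : ∀ {M} → E 𝔐 ind M → ∀ N P → M ⊑ P →
                      ∃[ f ] (Fixes f ∣ M ∣ᴹ × ∣ imageModel f N ∣ᴹ ↓[ M ] P)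
    independentCopy {M} E-M N P M⊑P
      with A , (f , fA≡N) , A↓P ← extension E-M ∣ N ∣ᴹ P M⊑P
      with fixes , N⊆A , _ ← ≡-sym f A ∣ N ∣ᴹ ∣ M ∣ᴹ fA≡N =
      ≅-sym f , fixes , monotonicity A↓P N⊆A M⊑P (⊑-refl P)

  module _ (ind₁ ind₂ : Independence 𝔐) {M : Mdl} where
    open Independence ind₁ renaming (_↓[_]_ to _↓₁[_]_) using ()
    open Independence ind₂ renaming (_↓[_]_ to _↓₂[_]_) using ()

    ⊆⇒⊇ : E 𝔐 ind₁ M → U 𝔐 ind₂ M →
          (∀ {A N} → A ↓₁[ M ] N → A ↓₂[ M ] N) →
          ∀ {A N} → A ↓₂[ M ] N → A ↓₁[ M ] N
    ⊆⇒⊇ E₁ U₂ ₁⇒₂ {A} {N} A↓₂N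
      with A′ , (f , fA′≡A) , A′↓₁N ← extension ind₁ E₁ A N (Independence.base ind₂ A↓₂N)
      with g , gA′≡A , _ ← U₂ (₁⇒₂ A′↓₁N) A↓₂N f fA′≡A =
      ↓-resp-≡ ind₁ g gA′≡A A′↓₁N

  -- A chain of stages with independent copies of `N`

  module IndependentChain (ind : Independence 𝔐) {M : Mdl} (E-M : E 𝔐 ind M) (N : Mdl)
                          (μ : RegularCardinal ℓ) where
    open Independence ind
    module μ = RegularCardinal μ

    start : Carrier
    start = proj₁ (directed (rank M) (rank N))

    M<start : rank M < start
    M<start = proj₁ (proj₂ (directed (rank M) (rank N)))

    N<start : rank N < start
    N<start = proj₂ (proj₂ (directed (rank M) (rank N)))

    -- next has to be total, so stages that may not contain M are enlarged first.
    above : Carrier → Carrier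
    above i = proj₁ (directed i start)

    i<above : ∀ i → i < above i
    i<above i = proj₁ (proj₂ (directed i start))

    start<above : ∀ i → start < above i
    start<above i = proj₂ (proj₂ (directed i start))

    copyOver : ∀ i → ∃[ f ] (Fixes f ∣ M ∣ᴹ × ∣ imageModel f N ∣ᴹ ↓[ M ] stageModel (above i))
    copyOver i = independentCopy ind E-M N (stageModel (above i))
      (⊑-stage M (≤-trans (inj₁ M<start) (inj₁ (start<above i))))

    -- Bounding the rank of the copy makes every later stage of the chain swallow it.
    next : Carrier → Carrier
    next i = proj₁ (directed (above i) (rank (imageModel (proj₁ (copyOver i)) N)))

    i<next : ∀ i → i < next i
    i<next i = ≤-<-trans (inj₁ (i<above i)) (proj₁ (proj₂ (directed (above i) _)))

    open NormalFunction (<⁺-wellFounded μ.wellFounded) start next i<next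

    chain : μ.Carrier ⁺ → Mdl
    chain = stageModel ∘ normal

    M⊑chain : ∀ i → M ⊑ chain i
    M⊑chain i = ⊑-stage M (≤-trans (inj₁ M<start) (start≤normal i))

    N⊑chain : ∀ i → N ⊑ chain i
    N⊑chain i = ⊑-stage N (≤-trans (inj₁ N<start) (start≤normal i))

    isChain : IsChain 𝔐 μ chain
    isChain = record
      { increasing = λ i<j → stage-mono (inj₁ (normal-strict i<j))
      ; continuous = λ δ-limit x →
          let k , k<δ , x∈k = continuous (normal-isLimitPoint δ-limit) x
              j , j<δ , k<j = normal-cofinal δ-limit k<δ
          in j , j<δ , stage-⊆ (inj₁ k<j) x∈k
      }

    copy : ∀ i → ∃[ f ] (Fixes f ∣ M ∣ᴹ × ∣ imageModel f N ∣ᴹ ↓[ M ] chain i ×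
                         (∀ {j} → _<⁺_ μ._<_ i j → imageModel f N ⊑ chain j))
    copy i = f , proj₁ (proj₂ (copyOver (normal i))) ,
      -- The copy is independent from the larger stage at `above (normal i)`; this is cut down to
      -- `chain i`.
      monotonicity (proj₂ (proj₂ (copyOver (normal i)))) id (M⊑chain i)
        (stage-mono (inj₁ (i<above (normal i)))) ,
      λ i<j → ⊑-stage (imageModel f N) (≤-trans
        (inj₁ (proj₂ (proj₂ (directed (above (normal i)) (rank (imageModel f N))))))
        (next≤normal i<j))
      where
      f : Auto
      f = proj₁ (copyOver (normal i))

  abstract
    -- (L) reveals its index only after the copy of `A` has been placed against the union, so a copy
    -- of `N` is prepared at every index. `N ⊑ chain ⊤⁺` lets (E) for the other relation extend from
    -- `N` to the union.
    independentChain : ∀ (ind : Independence 𝔐) {M} → E 𝔐 ind M → ∀ N μ →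
      let open Independence ind
      in Σ[ chain ∈ (RegularCardinal.Carrier μ ⁺ → Mdl) ] (IsChain 𝔐 μ chain × N ⊑ chain ⊤⁺ ×
           (∀ i → ∃[ f ] (Fixes f ∣ M ∣ᴹ × ∣ imageModel f N ∣ᴹ ↓[ M ] chain [ i ] ×
                          imageModel f N ⊑ chain ⊤⁺)))
    independentChain ind E-M N μ = chain , isChain , N⊑chain ⊤⁺ , λ i →
      let f , fixes , N′↓i , N′⊑ = copy [ i ] in f , fixes , N′↓i , N′⊑ [ i ]<⊤⁺
      where open IndependentChain ind E-M N μ

  -- A ↓[ M ] P is not available, so (T∗) cannot be applied to A itself; (S)
  -- turns the question around to N, for which N ↓[ M ] P is known.
  swap : ∀ (ind : Independence 𝔐) {M} → S 𝔐 ind → T∗ 𝔐 ind M →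
         let open Independence ind in
         ∀ {A N P Q} → M ⊑ N → N ⊑ Q →
         ∣ N ∣ᴹ ↓[ M ] P → A ↓[ P ] Q → A ↓[ M ] N
  swap ind {M} S-ind T∗-M {A} {N} {P} {Q} M⊑N N⊑Q N↓P A↓Q
    -- First use of (S), over `P`: it also encloses `A` in a model, so that (T∗) can take `A⁺` as
    -- its top model.
    with A⁺ , P⊑A⁺ , A⊆A⁺ , Q↓A⁺ ← proj₁ (S-ind A↓Q) =
    monotonicity A⁺↓N A⊆A⁺ M⊑N (⊑-refl N)
    where
    open Independence ind

    N↓A⁺ : ∣ N ∣ᴹ ↓[ M ] A⁺
    N↓A⁺ = T∗-M (base N↓P) P⊑A⁺ N↓P (monotonicity Q↓A⁺ (⊑⇒⊆ N Q N⊑Q) P⊑A⁺ (⊑-refl A⁺))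

    -- Second use of (S), over `M`, in its clause for models: `N` is itself a model extending `M`
    -- and need not be enlarged.
    A⁺↓N : ∣ A⁺ ∣ᴹ ↓[ M ] N
    A⁺↓N = proj₂ (S-ind N↓A⁺) (id , id) M⊑N

  -- Comparing the two relations

  module _ (ind₁ ind₂ : Independence 𝔐) {M : Mdl} where
    open Independence ind₁ renaming (_↓[_]_ to _↓₁[_]_) using ()
    open Independence ind₂ renaming (_↓[_]_ to _↓₂[_]_) using ()

    transfer : U 𝔐 ind₁ M → ∀ {A A′ N} f g → Fixes f ∣ M ∣ᴹ → g ∶ A′ ≡⟨ ∣ N ∣ᴹ ⟩ A →
               A ↓₁[ M ] N → A′ ↓₁[ M ] imageModel f N → A′ ↓₂[ M ] imageModel f N →
               A ↓₂[ M ] N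
    transfer U₁ {A} {A′} {N} f g f-fixes (g-fixes , gA′≐A) A↓₁N A′↓₁N′ A′↓₂N′ =
      let M⊑N = Independence.base ind₁ A↓₁N
          fA↓₁N′ = Equivalence.to (↓-imageModel ind₁ {A} {M} {N} f f-fixes) A↓₁N
          -- `≅-trans g f` applies `g` first, taking `A′` to `A` and then to `f · A`. It is only
          -- known to fix `M`; (U) replaces it by an `h` fixing the image of `N`, along which
          -- `f · A` inherits `↓₂`.
          h , hA′≡fA , _ = U₁ A′↓₁N′ fA↓₁N′ (≅-trans g f)
            (≡-trans g f A′ A (_·_ 𝔐 f A) ∣ M ∣ᴹ (g-fixes ∘ ⊑⇒⊆ M N M⊑N , gA′≐A)
                     (f-fixes , id , id))
      in Equivalence.from (↓-imageModel ind₂ {A} {M} {N} f f-fixes) (↓-resp-≡ ind₂ h hA′≡fA A′↓₂N′)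

    inclusion : E 𝔐 ind₁ M → U 𝔐 ind₁ M →
                E 𝔐 ind₂ M → L 𝔐 ind₂ → S 𝔐 ind₂ → T∗ 𝔐 ind₂ M →
                ∀ {A N} → A ↓₁[ M ] N → A ↓₂[ M ] N
    inclusion (_ , extend₁) U₁ E₂ L₂ S₂ T∗₂ {A} {N} A↓₁N =
      let M⊑N = Independence.base ind₁ A↓₁N
          -- The size is taken from `A`, because `A′` depends on the chain and the length of the
          -- chain on `α`.
          α , A-size = hasSize A
          μ , local , _ = L₂ α
          chain , isChain , N⊑Q , copies = independentChain ind₂ E₂ N μ
          A′ , (g , gA′≡A) , A′↓₁Q = extend₁ {N′ = chain ⊤⁺} M⊑N N⊑Q A↓₁N
          A′-size = hasSize-≡ (≅-sym g) A A′ ∣ N ∣ᴹ (≡-sym g A′ A ∣ N ∣ᴹ gA′≡A) A-size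
          -- The chain has length exactly `κ_α`, so the identity witnesses the bound on its length.
          i , A′↓₂Q = local μ (↣-id _) chain isChain A′ A′-size
          f , f-fixes , N′↓₂P , N′⊑Q = copies i
          -- `f` fixes `M` pointwise, so `M` stays inside the image of `N`; inclusion of models is
          -- enough for `⊑`.
          M⊑N′ = ⊆⇒⊑ M (imageModel f N) λ c∈M →
            let x , x≡c = ⊑⇒⊆ M N M⊑N c∈M in x , trans (cong (to f) x≡c) (f-fixes c∈M)
      in transfer U₁ f g f-fixes gA′≡A A↓₁N
           (Independence.monotonicity ind₁ A′↓₁Q id M⊑N′ N′⊑Q)
           (swap ind₂ S₂ T∗₂ M⊑N′ N′⊑Q N′↓₂P A′↓₂Q)

corollary4p14 : {ℓ : Level} → ExcludedMiddle (lsuc ℓ) →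
    {τ : Vocabulary ℓ} (K : AEC τ) →
    Amalgamation K → JointEmbedding K → NoMaximalModels K →
    (𝔐 : Monster K) (ind₁ ind₂ : Independence 𝔐) (M : Model 𝔐) →
    E 𝔐 ind₁ M → U 𝔐 ind₁ M →
    E 𝔐 ind₂ M → U 𝔐 ind₂ M → L 𝔐 ind₂ → S 𝔐 ind₂ → T∗ 𝔐 ind₂ M →
    let open Independence ind₁ renaming (_↓[_]_ to _↓₁[_]_) using ()
        open Independence ind₂ renaming (_↓[_]_ to _↓₂[_]_) using ()
    in ∀ A N → (A ↓₁[ M ] N) ⇔ (A ↓₂[ M ] N)
corollary4p14 em K _ _ _ 𝔐 ind₁ ind₂ M E₁ U₁ E₂ U₂ L₂ S₂ T∗₂ A N =
  mk⇔ ₁⇒₂ (⊆⇒⊇ ind₁ ind₂ E₁ U₂ ₁⇒₂)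
  where
  open MonsterProperties em 𝔐
  open Independence ind₁ renaming (_↓[_]_ to _↓₁[_]_) using ()
  open Independence ind₂ renaming (_↓[_]_ to _↓₂[_]_) using ()

  ₁⇒₂ : ∀ {A N} → A ↓₁[ M ] N → A ↓₂[ M ] N
  ₁⇒₂ = inclusion ind₁ ind₂ E₁ U₁ E₂ L₂ S₂ T∗₂
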